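{- Let $G$ be a graph with $V(G)=\{u_1,\ldots,u_n\}$ such that $\{u_1,\ldots,u_\ell\}$ induces a clique in $G$ and $\ell<n$. If $H_1,\ldots,H_\ell$ are pairwise disjoint complete graphs and $H_{\ell+1},\ldots,H_n$ are pairwise disjoint graphs (all $H_1,\ldots,H_n$ pairwise disjoint), then $box(G[H_1,H_2,\ldots,H_n])\leq \sum_{i=\ell+1}^{n} box(H_i)$.
   Context: All graphs are simple, finite and undirected. For a graph $G$ with vertex set $\{u_1,\ldots,u_n\}$ and pairwise disjoint graphs $H_1,\ldots,H_n$, the $G$-generalized join $G[H_1,\ldots,H_n]$ is the graph obtained from $G$ by replacing each vertex $u_i$ by $H_i$ and joining every vertex of $H_i$ to every vertex of $H_j$ whenever $u_i$ is adjacent to $u_j$ in $G$. The boxicity $box(G)$ is the least positive integer $\ell$ such that $G$ is isomorphic to the intersection graph of a family of $\ell$-boxes (Cartesian products of $\ell$ closed bounded real intervals). -}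

module Defs where

open import Axiom.UniquenessOfIdentityProofs using (module Decidable⇒UIP)
open import Data.Fin.Base using (Fin)
import Data.Fin.Properties as Fin
open import Data.Nat.Base using (ℕ; _≤_)
open import Data.Product.Base using (Σ; Σ-syntax; ∃-syntax; _×_; _,_)
open import Data.Product.Properties using (,-injectiveʳ-UIP)
open import Data.Rational.Base as ℚ using (ℚ)
open import Data.Sum.Base using (_⊎_)
open import Function.Bundles using (_↔_; _⇔_; Inverse)
open import Level using (Level; 0ℓ; _⊔_) renaming (suc to lsuc)
open import Relation.Binary.Core using (Rel)
open import Relation.Binary.Definitions using (Decidable; Symmetric)
open import Relation.Binary.PropositionalEquality
  using (_≡_; _≢_; refl; sym; cong)
open import Relation.Nullary.Negation using (¬_)
open import Relation.Unary using (Pred; _≬_; U)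

private
  variable
    a ℓ ℓ₁ ℓ₂ : Level

-- The standard library has no real numbers.  These are the two-sided Dedekind
-- reals: `Lower q` means q < x and `Upper q` means x < q.

record ℝ : Set₁ where
  field
    Lower           : Pred ℚ 0ℓ
    Upper           : Pred ℚ 0ℓ
    lower-inhabited : ∃[ q ] Lower q
    upper-inhabited : ∃[ q ] Upper q
    lower-rounded   : ∀ q → Lower q ⇔ (∃[ r ] (q ℚ.< r × Lower r))
    upper-rounded   : ∀ r → Upper r ⇔ (∃[ q ] (q ℚ.< r × Upper q))
    disjoint        : ∀ q → ¬ (Lower q × Upper q)
    located         : ∀ {q r} → q ℚ.< r → Lower q ⊎ Upper r

infix 4 _≤ᴿ_

_≤ᴿ_ : ℝ → ℝ → Set
x ≤ᴿ y = ∀ {q} → ℝ.Lower x q → ℝ.Lower y q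

record Interval : Set₁ where
  field
    left       : ℝ
    right      : ℝ
    left≤right : left ≤ᴿ right

⟦_⟧ᴵ : Interval → Pred ℝ 0ℓ
⟦ I ⟧ᴵ x = Interval.left I ≤ᴿ x × x ≤ᴿ Interval.right I

Box : ℕ → Set₁
Box k = Fin k → Interval

⟦_⟧ : ∀ {k} → Box k → Pred (Fin k → ℝ) 0ℓ
⟦ B ⟧ p = ∀ i → ⟦ B i ⟧ᴵ (p i)

-- `Adj` lives at an arbitrary level because ℝ, and hence adjacency in an
-- intersection graph of boxes, lives in Set₁.

record Graph (ℓ : Level) : Set (lsuc ℓ) where
  field
    V      : Set
    Adj    : Rel V ℓ
    symm   : Symmetric Adj
    irrefl : ∀ {v} → ¬ Adj v v

open Graph public using (V; Adj)

-- Classically `adj?` is automatic; constructively it is part of what it means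
-- for a graph to be a finite object.

record IsFinite (G : Graph ℓ) : Set ℓ where
  field
    order       : ℕ
    enumeration : Fin order ↔ V G
    adj?        : Decidable (Adj G)

IsClique : (G : Graph ℓ₁) → Pred (V G) ℓ₂ → Set _
IsClique G S = ∀ {x y} → S x → S y → x ≢ y → Adj G x y

IsComplete : Graph ℓ → Set ℓ
IsComplete G = IsClique G U

record _≅_ (G : Graph ℓ₁) (H : Graph ℓ₂) : Set (ℓ₁ ⊔ ℓ₂) where
  field
    bijection : V G ↔ V H
    preserves : ∀ x y → Adj G x y ⇔
                  Adj H (Inverse.to bijection x) (Inverse.to bijection y)

intersectionGraph : {A : Set a} {I : Set} → (I → Pred A ℓ) → Graph (a ⊔ ℓ)
intersectionGraph {I = I} F = record
  { V      = I
  ; Adj    = λ i j → i ≢ j × F i ≬ F j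
  ; symm   = λ (i≢j , x , x∈Fi , x∈Fj) → (λ j≡i → i≢j (sym j≡i)) , x , x∈Fj , x∈Fi
  ; irrefl = λ (i≢i , _) → i≢i refl
  }

IsBoxGraph : Graph ℓ → ℕ → Set _
IsBoxGraph G k =
  Σ[ I ∈ Set ] Σ[ B ∈ (I → Box k) ] G ≅ intersectionGraph (λ i → ⟦ B i ⟧)

-- `IsBoxicity G k` says that box(G) = k.  It is a relation, because a function
-- computing the least k would need `IsBoxGraph G` to be decidable.

record IsBoxicity (G : Graph ℓ) (k : ℕ) : Set (ℓ ⊔ lsuc 0ℓ) where
  field
    positive  : 1 ≤ k
    boxGraph  : IsBoxGraph G k
    minimal   : ∀ {m} → 1 ≤ m → IsBoxGraph G m → k ≤ m

-- The generalized join G[H₁,…,Hₙ] with respect to a numbering u of the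
-- vertices of G.  Its vertices are tagged by the index i, so that the Hᵢ are
-- automatically made pairwise disjoint.

module _ {n : ℕ} (G : Graph 0ℓ) (u : Fin n ↔ V G) (H : Fin n → Graph 0ℓ) where

  data JoinAdj : Rel (Σ (Fin n) (λ i → V (H i))) 0ℓ where
    inside : ∀ {i x y} → Adj (H i) x y → JoinAdj (i , x) (i , y)
    across : ∀ {i j x y} → Adj G (Inverse.to u i) (Inverse.to u j) →
             JoinAdj (i , x) (j , y)

  private
    joinAdj⇒≢ : ∀ {p q} → JoinAdj p q → p ≢ q
    joinAdj⇒≢ (inside {i} x~y) p≡q
      with refl ← ,-injectiveʳ-UIP (Decidable⇒UIP.≡-irrelevant Fin._≟_) p≡q
      = Graph.irrefl (H i) x~y
    joinAdj⇒≢ (across ui~uj) refl = Graph.irrefl G ui~uj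

  generalizedJoin : Graph 0ℓ
  generalizedJoin = record
    { V      = Σ (Fin n) (λ i → V (H i))
    ; Adj    = JoinAdj
    ; symm   = λ { (inside {i} x~y) → inside (Graph.symm (H i) x~y)
                 ; (across ui~uj)   → across (Graph.symm G ui~uj) }
    ; irrefl = λ p~p → joinAdj⇒≢ p~p refl
    }

{-# OPTIONS --safe #-}

-- For every index i ≥ ℓ take a block of box(Hᵢ) coordinates.  On that block Hᵢ keeps
-- an optimal representation, contained in some [L,R]; the vertices of Hⱼ are
-- represented by [L,R+1] if uⱼ is adjacent to uᵢ, and by the point R+1 otherwise.  No
-- adjacency of the join is lost, and the block separates every non-adjacent pair that
-- meets Hᵢ.  Since u₁,…,u_ℓ form a clique and H₁,…,H_ℓ are complete, every non-adjacent
-- pair meets some Hᵢ with i ≥ ℓ, so the blocks together represent the join.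

module Submission where

open import Defs
open import Data.Empty using (⊥-elim)
open import Data.Fin.Base using (Fin; toℕ; zero; suc; fromℕ<; splitAt; _↑ˡ_; _↑ʳ_)
import Data.Fin.Properties as Fin
open import Data.List.Base using (List; _∷_; allFin; filter; map)
open import Data.List.Membership.Propositional using (_∈_)
open import Data.List.Membership.Propositional.Properties using (∈-filter⁺; ∈-allFin)
open import Data.List.Relation.Unary.Any using (here; there)
open import Data.Nat.Base using (ℕ; _<_; _≤_; z≤n; s≤s)
open import Data.Nat.ListAction using (sum)
import Data.Nat.Properties as ℕ
open import Data.Nat.Properties using (_≤?_)
open import Data.Product.Base using (Σ; ∃; ∃-syntax; _×_; _,_; proj₁; proj₂)
open import Data.Rational.Base as ℚ using (ℚ; 1ℚ)
import Data.Rational.Properties as ℚ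
open import Data.Sum.Base using (_⊎_; inj₁; inj₂; [_,_]′)
open import Function.Base using (_∘_)
open import Function.Bundles using (_↔_; Equivalence; Injection; Inverse; mk⇔)
open import Function.Construct.Identity using (↔-id)
open import Function.Properties.Inverse using (Inverse⇒Injection)
open import Level using (Level; 0ℓ)
open import Relation.Binary.Core using (Rel)
open import Relation.Binary.Definitions using (tri<; tri≈; tri>)
open import Relation.Binary.PropositionalEquality
  using (_≡_; _≢_; refl; sym; cong; subst)
open import Relation.Nullary.Decidable.Core using (yes; no)
open import Relation.Nullary.Negation using (¬_)
open import Relation.Unary using (Pred; _≬_)
open import Relation.Unary.Properties using (≬-sym)

private
  variable
    a p r : Level
    k n : ℕ

-- Rational numbers as Dedekind reals

p<p+1 : ∀ x → x ℚ.< x ℚ.+ 1ℚ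
p<p+1 x = subst (ℚ._< x ℚ.+ 1ℚ) (ℚ.+-identityʳ x) (ℚ.+-monoʳ-< x (ℚ.positive⁻¹ 1ℚ))

p-1<p : ∀ x → x ℚ.- 1ℚ ℚ.< x
p-1<p x = subst (x ℚ.- 1ℚ ℚ.<_) (ℚ.+-identityʳ x) (ℚ.+-monoʳ-< x (ℚ.negative⁻¹ (ℚ.- 1ℚ)))

fromℚ : ℚ → ℝ
fromℚ x = record
  { Lower           = ℚ._< x
  ; Upper           = x ℚ.<_
  ; lower-inhabited = x ℚ.- 1ℚ , p-1<p x
  ; upper-inhabited = x ℚ.+ 1ℚ , p<p+1 x
  ; lower-rounded   = λ q → mk⇔ ℚ.<-dense λ (s , q<s , s<x) → ℚ.<-trans q<s s<x
  ; upper-rounded   = λ q → mk⇔ (λ x<q → let s , x<s , s<q = ℚ.<-dense x<q in s , s<q , x<s)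
                                λ (s , s<q , x<s) → ℚ.<-trans x<s s<q
  ; disjoint        = λ q (q<x , x<q) → ℚ.<-asym q<x x<q
  ; located         = λ {q} q<s → located q<s (ℚ.<-cmp q x)
  }
  where
  located : ∀ {q s} → q ℚ.< s → _ → q ℚ.< x ⊎ x ℚ.< s
  located q<s (tri< q<x _ _)  = inj₁ q<x
  located q<s (tri≈ _ refl _) = inj₂ q<s
  located q<s (tri> _ _ x<q)  = inj₂ (ℚ.<-trans x<q q<s)

fromℚ-mono-≤ : ∀ {x y} → x ℚ.≤ y → fromℚ x ≤ᴿ fromℚ y
fromℚ-mono-≤ x≤y q<x = ℚ.<-≤-trans q<x x≤y

-- The rational `x` lies in the lower cut of `fromℚ y` but not in its own.
<⇒fromℚ≰ : ∀ {x y} → x ℚ.< y → ¬ (fromℚ y ≤ᴿ fromℚ x)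
<⇒fromℚ≰ x<y y≤x = ℚ.<-irrefl refl (y≤x x<y)

Lower⇒fromℚ≤ : ∀ (x : ℝ) {q} → ℝ.Lower x q → fromℚ q ≤ᴿ x
Lower⇒fromℚ≤ x q<x s<q = Equivalence.from (ℝ.lower-rounded x _) (_ , s<q , q<x)

-- `_≤ᴿ_` compares lower cuts only. A rational `s` of the lower cut with `s` at least `q` would also
-- lie in the upper cut, by roundedness, against disjointness.
Upper⇒≤fromℚ : ∀ (x : ℝ) {q} → ℝ.Upper x q → x ≤ᴿ fromℚ q
Upper⇒≤fromℚ x {q} x<q {s} s<x with ℚ.<-cmp s q
... | tri< s<q _ _  = s<q
... | tri≈ _ refl _ = ⊥-elim (ℝ.disjoint x q (s<x , x<q))
... | tri> _ _ q<s  =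
  ⊥-elim (ℝ.disjoint x s (s<x , Equivalence.from (ℝ.upper-rounded x s) (q , q<s , x<q)))

≤ᴿ-refl : ∀ x → x ≤ᴿ x
≤ᴿ-refl _ q<x = q<x

≤ᴿ-trans : ∀ x y z → x ≤ᴿ y → y ≤ᴿ z → x ≤ᴿ z
≤ᴿ-trans _ _ _ x≤y y≤z q<x = y≤z (x≤y q<x)

-- Common bounds of finite families

module _ {A : Set a} {_≼_ : Rel A r}
         (default : A) (directed : ∀ x y → ∃[ z ] (x ≼ z × y ≼ z)) where

  -- Induction on `m`: directedness merges the bound of the head with that of the tail. An arbitrary
  -- monotone `P i` lets the lemma be nested, over vertices and then over coordinates.
  commonBound : ∀ {m} (P : Fin m → Pred A p) →
                (∀ i {x y} → x ≼ y → P i x → P i y) →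
                (∀ i → ∃ (P i)) → ∃[ x ] (∀ i → P i x)
  commonBound {m = ℕ.zero}  P mono bounds = default , λ ()
  commonBound {m = ℕ.suc _} P mono bounds =
    let x , Px     = bounds zero
        y , Py     = commonBound (P ∘ suc) (mono ∘ suc) (bounds ∘ suc)
        z , xz , yz = directed x y
    in z , λ { zero → mono zero xz Px ; (suc i) → mono (suc i) yz (Py i) }

commonUpperBound : ∀ {m} (x : Fin m → Fin k → ℝ) →
                   ∃[ q ] (∀ i j → x i j ≤ᴿ fromℚ q)
commonUpperBound x =
  bound (λ i q → ∀ j → x i j ≤ᴿ fromℚ q) (λ i q≤s b j → mono (x i j) q≤s (b j)) λ i →
  bound (λ j q → x i j ≤ᴿ fromℚ q) (λ j → mono (x i j)) λ j →
  let q , x<q = ℝ.upper-inhabited (x i j) in q , Upper⇒≤fromℚ (x i j) x<q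
  where
  mono : ∀ y {q s} → q ℚ.≤ s → y ≤ᴿ fromℚ q → y ≤ᴿ fromℚ s
  mono y {q} {s} q≤s y≤q = ≤ᴿ-trans y (fromℚ q) (fromℚ s) y≤q (fromℚ-mono-≤ q≤s)

  bound : ∀ {m} (P : Fin m → Pred ℚ 0ℓ) → _
  -- The default `1ℚ` is arbitrary; it is returned only for an empty family.
  bound = commonBound {_≼_ = ℚ._≤_} 1ℚ (λ q s → q ℚ.⊔ s , ℚ.p≤p⊔q q s , ℚ.p≤q⊔p q s)

commonLowerBound : ∀ {m} (x : Fin m → Fin k → ℝ) →
                   ∃[ q ] (∀ i j → fromℚ q ≤ᴿ x i j)
commonLowerBound x =
  bound (λ i q → ∀ j → fromℚ q ≤ᴿ x i j) (λ i s≤q b j → mono (x i j) s≤q (b j)) λ i →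
  bound (λ j q → fromℚ q ≤ᴿ x i j) (λ j → mono (x i j)) λ j →
  let q , q<x = ℝ.lower-inhabited (x i j) in q , Lower⇒fromℚ≤ (x i j) q<x
  where
  mono : ∀ y {q s} → s ℚ.≤ q → fromℚ q ≤ᴿ y → fromℚ s ≤ᴿ y
  mono y {q} {s} s≤q q≤y = ≤ᴿ-trans (fromℚ s) (fromℚ q) y (fromℚ-mono-≤ s≤q) q≤y

  bound : ∀ {m} (P : Fin m → Pred ℚ 0ℓ) → _
  bound = commonBound {_≼_ = ℚ._≥_} 1ℚ (λ q s → q ℚ.⊓ s , ℚ.p⊓q≤p q s , ℚ.p⊓q≤q q s)

-- Box representations indexed by vertices

record BoxRepresentation (G : Graph 0ℓ) (k : ℕ) : Set₁ where
  field
    box      : V G → Box k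
    adj⇒meet : ∀ {x y} → Adj G x y → ⟦ box x ⟧ ≬ ⟦ box y ⟧
    meet⇒adj : ∀ {x y} → x ≢ y → ⟦ box x ⟧ ≬ ⟦ box y ⟧ → Adj G x y

fromIsBoxGraph : ∀ {G} → IsBoxGraph G k → BoxRepresentation G k
fromIsBoxGraph {G = G} (I , B , iso) = record
  { box      = B ∘ to
  ; adj⇒meet = λ x~y → proj₂ (Equivalence.to (preserves _ _) x~y)
  ; meet⇒adj = λ x≢y meet →
      Equivalence.from (preserves _ _) (x≢y ∘ Injection.injective (Inverse⇒Injection bijection) , meet)
  }
  where
  open _≅_ iso
  open Inverse bijection using (to)

toIsBoxGraph : ∀ {G} → BoxRepresentation G k → IsBoxGraph G k
toIsBoxGraph {G = G} rep = V G , box , record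
  { bijection = ↔-id (V G)
  ; preserves = λ x y → mk⇔
      (λ x~y → (λ { refl → Graph.irrefl G x~y }) , adj⇒meet x~y)
      (λ (x≢y , meet) → meet⇒adj x≢y meet)
  }
  where open BoxRepresentation rep

record Within (L R : ℚ) (B : Box k) : Set where
  field
    lower : ∀ j → fromℚ L ≤ᴿ Interval.left (B j)
    upper : ∀ j → Interval.right (B j) ≤ᴿ fromℚ R

-- The lower bound is L ⊓ R because A may be empty, and then nothing forces L ≤ R.
boundedFamily : ∀ {A : Set} → Fin n ↔ A → (B : A → Box k) →
                ∃[ L ] ∃[ R ] (L ℚ.≤ R × (∀ x → Within L R (B x)))
boundedFamily enum B =
  let L , lower = commonLowerBound (λ i j → Interval.left (B (to i) j))
      R , upper = commonUpperBound (λ i j → Interval.right (B (to i) j))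
  -- The bounds are known at enumerated vertices, so they are transported along `to (from x) ≡ x`.
  in L ℚ.⊓ R , R , ℚ.p⊓q≤q L R , λ x → subst (Within (L ℚ.⊓ R) R ∘ B) (strictlyInverseˡ x) (record
       { lower = λ j → ≤ᴿ-trans (fromℚ (L ℚ.⊓ R)) (fromℚ L) (Interval.left (B (to (from x)) j))
                         (fromℚ-mono-≤ (ℚ.p⊓q≤p L R)) (lower (from x) j)
       ; upper = upper (from x)
       })
  where open Inverse enum

-- Coordinates of a concatenation of blocks

module _ {A : Set} {b : A → ℕ} where

  locate : ∀ xs → Fin (sum (map b xs)) → Σ A (Fin ∘ b)
  locate (x ∷ xs) m = [ (x ,_) , locate xs ]′ (splitAt (b x) m)

  index : ∀ {x xs} → x ∈ xs → Fin (b x) → Fin (sum (map b xs))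
  index {x} (here refl)          c = c ↑ˡ _
  index {xs = y ∷ _} (there x∈xs) c = b y ↑ʳ index x∈xs c

  -- Only this composite is needed: it lets a point of the concatenation be restricted to one block.
  locate-index : ∀ {x xs} (x∈xs : x ∈ xs) c → locate xs (index x∈xs c) ≡ (x , c)
  locate-index {x} {_ ∷ xs} (here refl) c
    rewrite Fin.splitAt-↑ˡ (b x) c (sum (map b xs)) = refl
  locate-index {xs = y ∷ xs} (there x∈xs) c
    rewrite Fin.splitAt-↑ʳ (b y) (sum (map b xs)) (index x∈xs c) = locate-index x∈xs c

-- The block of coordinates belonging to one index

module _ {n : ℕ} (G : Graph 0ℓ) (u : Fin n ↔ V G) (H : Fin n → Graph 0ℓ) where

  open Inverse u using (to)

  private
    J = generalizedJoin G u H

  -- The intersection graph of a block may have more edges than `J`, but it is exact on pairs that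
  -- meet `H i`.
  record Block (i : Fin n) (k : ℕ) : Set₁ where
    field
      box      : V J → Box k
      adj⇒meet : ∀ {v w} → Adj J v w → ⟦ box v ⟧ ≬ ⟦ box w ⟧
      meet⇒adj : ∀ {x w} → (i , x) ≢ w → ⟦ box (i , x) ⟧ ≬ ⟦ box w ⟧ → Adj J (i , x) w

  module _ (finite : IsFinite G) (i : Fin n) (rep : BoxRepresentation (H i) k) (c₀ : Fin k)
           {L R : ℚ} (L≤R : L ℚ.≤ R)
           (within : ∀ x → Within L R (BoxRepresentation.box rep x)) where

    open BoxRepresentation rep

    private
      -- Each case stores its evidence, so impossible combinations can be refuted by matching alone,
      -- without unfolding the decisions made in `place`.
      data Place : Fin n → Set where
        same     : Place i
        adjacent : ∀ {j} → Adj G (to i) (to j) → Place j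
        apart    : ∀ {j} → i ≢ j → ¬ Adj G (to i) (to j) → Place j

      place : ∀ j → Place j
      place j with i Fin.≟ j | IsFinite.adj? finite (to i) (to j)
      ... | yes refl | _       = same
      ... | no _     | yes i~j = adjacent i~j
      ... | no i≢j   | no ¬i~j = apart i≢j ¬i~j

      far : ℝ
      far = fromℚ (R ℚ.+ 1ℚ)

      ≤R⇒≤far : ∀ x → x ≤ᴿ fromℚ R → x ≤ᴿ far
      ≤R⇒≤far x x≤R = ≤ᴿ-trans x (fromℚ R) far x≤R (fromℚ-mono-≤ (ℚ.<⇒≤ (p<p+1 R)))

      wide point : Interval
      wide  = record { left = fromℚ L ; right = far
                     ; left≤right = ≤R⇒≤far (fromℚ L) (fromℚ-mono-≤ L≤R) }
      point = record { left = far ; right = far ; left≤right = ≤ᴿ-refl far }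

      placeBox : ∀ {j} → Place j → V (H j) → Box k
      placeBox same          x   = box x
      placeBox (adjacent _)  _ _ = wide
      placeBox (apart _ _)   _ _ = point

      far∈wide : ⟦ wide ⟧ᴵ far
      far∈wide = Interval.left≤right wide , ≤ᴿ-refl far

      far∈point : ⟦ point ⟧ᴵ far
      far∈point = ≤ᴿ-refl far , ≤ᴿ-refl far

      -- The left corner of `box x` is a common point, since it lies between `L` and `R` in every
      -- coordinate.
      box-meets-wide : ∀ x → ⟦ box x ⟧ ≬ ⟦ (λ _ → wide) ⟧
      box-meets-wide x = Interval.left ∘ box x ,
        (λ c → ≤ᴿ-refl (left c) , Interval.left≤right (box x c)) ,
        (λ c → Within.lower (within x) c ,
               ≤R⇒≤far (left c) (≤ᴿ-trans (left c) (right c) (fromℚ R)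
                                   (Interval.left≤right (box x c)) (Within.upper (within x) c)))
        where
        left  = λ c → Interval.left  (box x c)
        right = λ c → Interval.right (box x c)

      -- One coordinate `c₀` suffices: there `box x` ends by `R`, short of `far`. With no
      -- coordinates at all, any two boxes would meet.
      box-misses-point : ∀ x → ¬ (⟦ box x ⟧ ≬ ⟦ (λ _ → point) ⟧)
      box-misses-point x (z , z∈box , z∈point) = <⇒fromℚ≰ (p<p+1 R)
        (≤ᴿ-trans far (z c₀) (fromℚ R) (proj₁ (z∈point c₀))
          (≤ᴿ-trans (z c₀) (Interval.right (box x c₀)) (fromℚ R)
            (proj₂ (z∈box c₀)) (Within.upper (within x) c₀)))

      -- `far` lies in both `wide` and `point`, so any two boxes outside `H i` meet. An edge between
      -- `same` and `apart` contradicts the evidence stored in `apart`.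
      placeBox-adj⇒meet : ∀ {j j′} (P : Place j) (Q : Place j′) {x y} →
                          Adj J (j , x) (j′ , y) → ⟦ placeBox P x ⟧ ≬ ⟦ placeBox Q y ⟧
      placeBox-adj⇒meet same           same           (inside x~y)  = adj⇒meet x~y
      placeBox-adj⇒meet same           same           (across i~i)  = ⊥-elim (Graph.irrefl G i~i)
      placeBox-adj⇒meet same           (adjacent _)   _             = box-meets-wide _
      placeBox-adj⇒meet same           (apart i≢i _)  (inside _)    = ⊥-elim (i≢i refl)
      placeBox-adj⇒meet same           (apart _ ¬i~j) (across i~j)  = ⊥-elim (¬i~j i~j)
      placeBox-adj⇒meet (adjacent _)   same           _             = ≬-sym (box-meets-wide _)
      placeBox-adj⇒meet (apart i≢i _)  same           (inside _)    = ⊥-elim (i≢i refl)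
      placeBox-adj⇒meet (apart _ ¬i~j) same           (across j~i)  = ⊥-elim (¬i~j (Graph.symm G j~i))
      placeBox-adj⇒meet (adjacent _)   (adjacent _)   _ = (λ _ → far) , (λ _ → far∈wide)  , (λ _ → far∈wide)
      placeBox-adj⇒meet (adjacent _)   (apart _ _)    _ = (λ _ → far) , (λ _ → far∈wide)  , (λ _ → far∈point)
      placeBox-adj⇒meet (apart _ _)    (adjacent _)   _ = (λ _ → far) , (λ _ → far∈point) , (λ _ → far∈wide)
      placeBox-adj⇒meet (apart _ _)    (apart _ _)    _ = (λ _ → far) , (λ _ → far∈point) , (λ _ → far∈point)

      -- A place of `i` itself can only be `same`. Then `Q` decides: `rep` settles `same`, the edge
      -- of `G` settles `adjacent`, and `apart` cannot meet.
      placeBox-meet⇒adj : ∀ {j} (P : Place i) (Q : Place j) {x y} → (i , x) ≢ (j , y) →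
                          ⟦ placeBox P x ⟧ ≬ ⟦ placeBox Q y ⟧ → Adj J (i , x) (j , y)
      placeBox-meet⇒adj (adjacent i~i) _              _   _    = ⊥-elim (Graph.irrefl G i~i)
      placeBox-meet⇒adj (apart i≢i _)  _              _   _    = ⊥-elim (i≢i refl)
      placeBox-meet⇒adj same           same           x≢y meet = inside (meet⇒adj (x≢y ∘ cong (i ,_)) meet)
      placeBox-meet⇒adj same           (adjacent i~j) _   _    = across i~j
      placeBox-meet⇒adj same           (apart _ _)    _   meet = ⊥-elim (box-misses-point _ meet)

    blockWithin : Block i k
    blockWithin = record
      { box      = λ (j , x) → placeBox (place j) x
      ; adj⇒meet = placeBox-adj⇒meet (place _) (place _)
      ; meet⇒adj = placeBox-meet⇒adj (place i) (place _)
      }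

  block : IsFinite G → ∀ i → IsFinite (H i) → BoxRepresentation (H i) k → 1 ≤ k → Block i k
  block finite i finiteH rep 1≤k =
    let L , R , L≤R , within = boundedFamily (IsFinite.enumeration finiteH) (BoxRepresentation.box rep)
    -- `1≤k` supplies the separating coordinate.
    in blockWithin finite i rep (fromℕ< 1≤k) L≤R within

  -- The blocks over a list of indices represent the join as soon as every
  -- non-adjacent pair of vertices meets some listed Hᵢ.
  concatBlocks : (b : Fin n → ℕ) → (∀ i → Block i (b i)) → (is : List (Fin n)) →
                 (∀ {v w} → v ≢ w → proj₁ v ∈ is ⊎ proj₁ w ∈ is ⊎ Adj J v w) →
                 BoxRepresentation J (sum (map b is))
  concatBlocks b B is cover = record
    { box      = λ v m → blockBox v (locate is m)
    ; adj⇒meet = λ v~w →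
        (λ m → proj₁ (meetAt v~w (locate is m))) ,
        (λ m → proj₁ (proj₂ (meetAt v~w (locate is m)))) ,
        (λ m → proj₂ (proj₂ (meetAt v~w (locate is m))))
    ; meet⇒adj = λ v≢w meet →
        [ (λ i∈is → Block.meet⇒adj (B _) v≢w (restrict i∈is meet))
        -- `Block.meet⇒adj` expects the vertex of the block first, so the pair is swapped.
        , [ (λ j∈is → Graph.symm J
              (Block.meet⇒adj (B _) (v≢w ∘ sym) (restrict j∈is (≬-sym meet))))
          , (λ v~w → v~w)
          ]′
        ]′ (cover v≢w)
    }
    where
    blockBox : V J → Σ (Fin n) (Fin ∘ b) → Interval
    blockBox v (i , c) = Block.box (B i) v c

    -- Boxes are products, so a common point may be chosen coordinate by coordinate, each time from
    -- the block concerned.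
    meetAt : ∀ {v w} → Adj J v w → ∀ l → ⟦ blockBox v l ⟧ᴵ ≬ ⟦ blockBox w l ⟧ᴵ
    meetAt v~w (i , c) = let z , z∈v , z∈w = Block.adj⇒meet (B i) v~w in z c , z∈v c , z∈w c

    restrict : ∀ {i v w} → i ∈ is → ⟦ blockBox v ∘ locate is ⟧ ≬ ⟦ blockBox w ∘ locate is ⟧ →
               ⟦ Block.box (B i) v ⟧ ≬ ⟦ Block.box (B i) w ⟧
    restrict {i} {v} {w} i∈is (z , z∈v , z∈w) =
      z ∘ index i∈is , (λ c → restrict-∈ v c (z∈v _)) , (λ c → restrict-∈ w c (z∈w _))
      where
      restrict-∈ : ∀ v c → ⟦ blockBox v (locate is (index i∈is c)) ⟧ᴵ (z (index i∈is c)) →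
                   ⟦ Block.box (B i) v c ⟧ᴵ (z (index i∈is c))
      restrict-∈ v c = subst (λ l → ⟦ blockBox v l ⟧ᴵ (z (index i∈is c))) (locate-index i∈is c)

theorem3p4 : ∀ {n ℓ : ℕ} (G : Graph 0ℓ) (u : Fin n ↔ V G) (H : Fin n → Graph 0ℓ) →
    IsFinite G → (∀ i → IsFinite (H i)) →
    ℓ < n →
    IsClique G (λ v → ∃[ i ] (toℕ i < ℓ × Inverse.to u i ≡ v)) →
    (∀ i → toℕ i < ℓ → IsComplete (H i)) →
    ∀ (box-H : Fin n → ℕ) (box-join : ℕ) →
    (∀ i → IsBoxicity (H i) (box-H i)) →
    IsBoxicity (generalizedJoin G u H) box-join →
    box-join ≤ sum (map box-H (filter (λ i → ℓ ≤? toℕ i) (allFin n)))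
theorem3p4 {n} {ℓ} G u H finiteG finiteH ℓ<n clique complete box-H box-join boxicity-H boxicity-join =
  -- Minimality applies only to a positive number of coordinates, hence `1≤sum`.
  IsBoxicity.minimal boxicity-join 1≤sum
    (toIsBoxGraph (concatBlocks G u H box-H blocks tail cover))
  where
  tail = filter (λ i → ℓ ≤? toℕ i) (allFin n)

  ∈-tail : ∀ {i} → ℓ ≤ toℕ i → i ∈ tail
  ∈-tail {i} = ∈-filter⁺ (λ i → ℓ ≤? toℕ i) (∈-allFin i)

  blocks : ∀ i → Block G u H i (box-H i)
  blocks i = block G u H finiteG i (finiteH i)
    (fromIsBoxGraph (IsBoxicity.boxGraph (boxicity-H i))) (IsBoxicity.positive (boxicity-H i))

  -- As `ℓ<n`, the index with value `ℓ` is in `tail`. Its block has a first coordinate, and an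
  -- element of `Fin` of the sum makes the sum positive.
  1≤sum : 1 ≤ sum (map box-H tail)
  1≤sum = ℕ.≤-trans (s≤s z≤n) (Fin.toℕ<n (index {b = box-H}
    (∈-tail (ℕ.≤-reflexive (sym (Fin.toℕ-fromℕ< ℓ<n))))
    (fromℕ< (IsBoxicity.positive (boxicity-H (fromℕ< ℓ<n))))))

  cover : ∀ {v w} → v ≢ w →
          proj₁ v ∈ tail ⊎ proj₁ w ∈ tail ⊎ Adj (generalizedJoin G u H) v w
  cover {i , x} {j , y} v≢w with ℓ ≤? toℕ i | ℓ ≤? toℕ j | i Fin.≟ j
  ... | yes ℓ≤i | _       | _        = inj₁ (∈-tail ℓ≤i)
  ... | no _    | yes ℓ≤j | _        = inj₂ (inj₁ (∈-tail ℓ≤j))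
  ... | no ℓ≰i  | no _    | yes refl =
    inj₂ (inj₂ (inside (complete i (ℕ.≰⇒> ℓ≰i) _ _ (v≢w ∘ cong (i ,_)))))
  ... | no ℓ≰i  | no ℓ≰j  | no i≢j   =
    -- `clique` asks for distinct vertices of `G`; injectivity of `u` provides them from `i≢j`.
    inj₂ (inj₂ (across (clique (i , ℕ.≰⇒> ℓ≰i , refl) (j , ℕ.≰⇒> ℓ≰j , refl)
      (i≢j ∘ Injection.injective (Inverse⇒Injection u)))))
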